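{- For integers $a,b\ge 1$, there exists a finite simple connected graph $G$ with $\mathrm{mp}^-(G)=a$ and $\mathrm{gp}^-(G)=b$ if and only if $a=b$, or $2\le a<b$, or $3\le b<a$.
   Context: A set $S$ of vertices of a connected graph $G$ is a general position set if no shortest path contains three or more vertices of $S$; it is maximal if not properly contained in another general position set; $\mathrm{gp}^-(G)$ is the number of vertices in a smallest maximal general position set. A path is monophonic (induced) if it has no chords between non-consecutive vertices. A set $M$ is in monophonic position if no induced path contains three or more vertices of $M$; $\mathrm{mp}^-(G)$ is the number of vertices in a smallest monophonic position set that is maximal by inclusion among monophonic position sets. -}

module Defs where

open import Data.Nat using (ℕ; zero; suc; _+_; _≤_)
open import Data.Fin using (Fin; toℕ)
open import Data.Bool using (Bool; true; false; T)
open import Data.List using (List; []; _∷_; length; lookup)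
open import Data.List.Relation.Unary.AllPairs using (AllPairs)
import Data.List.Membership.Propositional as LM
open import Data.Fin.Subset using (Subset; _∈_; _⊆_; ∣_∣)
open import Data.Product using (Σ; _×_; ∃; ∃-syntax)
open import Relation.Binary.PropositionalEquality using (_≡_; _≢_)
open import Relation.Nullary using (¬_)

record Graph : Set where
  field
    n     : ℕ
    adj   : Fin n → Fin n → Bool
    sym   : ∀ u v → adj u v ≡ adj v u
    irrefl : ∀ u → adj u u ≡ false

module _ (G : Graph) where
  open Graph G

  V : Set
  V = Fin n

  Adj : V → V → Set
  Adj u v = T (adj u v)

  data Walk : V → V → Set where
    [_]  : (u : V) → Walk u u
    _∷⟨_⟩_ : (u : V) {w v : V} → Adj u w → Walk w v → Walk u v

  verts : ∀ {u v} → Walk u v → List V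
  verts [ u ] = u ∷ []
  verts (u ∷⟨ _ ⟩ p) = u ∷ verts p

  len : ∀ {u v} → Walk u v → ℕ
  len [ u ] = 0
  len (u ∷⟨ _ ⟩ p) = suc (len p)

  IsPath : ∀ {u v} → Walk u v → Set
  IsPath p = AllPairs _≢_ (verts p)

  Connected : Set
  Connected = ∀ (u v : V) → Walk u v

  IsShortestPath : ∀ {u v} → Walk u v → Set
  IsShortestPath {u} {v} p =
    IsPath p × (∀ (q : Walk u v) → IsPath q → len p ≤ len q)

  IsInducedPath : ∀ {u v} → Walk u v → Set
  IsInducedPath p = IsPath p ×
    (∀ (i j : Fin (length (verts p))) → 2 + toℕ i ≤ toℕ j →
       ¬ Adj (lookup (verts p) i) (lookup (verts p) j))

  ContainsThree : Subset n → ∀ {u v} → Walk u v → Set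
  ContainsThree S p = ∃[ x ] ∃[ y ] ∃[ z ]
    (x ≢ y × y ≢ z × x ≢ z ×
     x ∈ S × y ∈ S × z ∈ S ×
     x LM.∈ verts p × y LM.∈ verts p × z LM.∈ verts p)

  IsGPSet : Subset n → Set
  IsGPSet S = ∀ {u v} (p : Walk u v) → IsShortestPath p → ¬ ContainsThree S p

  IsMPSet : Subset n → Set
  IsMPSet S = ∀ {u v} (p : Walk u v) → IsInducedPath p → ¬ ContainsThree S p

  IsMaximal : (Subset n → Set) → Subset n → Set
  IsMaximal P S = P S × (∀ T → P T → S ⊆ T → T ⊆ S)

  IsMinMaximalSize : (Subset n → Set) → ℕ → Set
  IsMinMaximalSize P k =
    (∃[ S ] (IsMaximal P S × ∣ S ∣ ≡ k)) ×
    (∀ S → IsMaximal P S → k ≤ ∣ S ∣)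

  GpMinus : ℕ → Set
  GpMinus = IsMinMaximalSize IsGPSet

  MpMinus : ℕ → Set
  MpMinus = IsMinMaximalSize IsMPSet

{-# OPTIONS --safe #-}
-- Necessity: shortest paths are induced, so every monophonic position set is in
-- general position, and a set of at most two vertices is always both.  Hence a maximal
-- general position set with at most two vertices is a maximal monophonic position set,
-- and a maximal monophonic position set with at most one vertex is the whole graph.
--
-- Sufficiency: replace the vertices of a small graph by cliques of prescribed sizes.
-- Twins never occur together with a third vertex on an induced path, so the maximal
-- sets of the blow-up are exactly the preimages of the maximal sets of the small graph.
-- A dominating vertex keeps the diameter at most 2, so general position then means
-- containing no induced P₃.  In the path p₀p₁p₂p₃ with a dominating vertex, {p₀, p₃} is a
-- maximal monophonic position set, but for general position it extends by p₁ or p₂;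
-- this gives a < b.  With a further vertex c adjacent to p₁ and p₂, every monophonic
-- position subset of {p₀, p₁, p₃} extends by c or by the dominating vertex, while the
-- set itself is a maximal general position set; making the other classes large gives b < a.
module Submission where

open import Defs
open import Data.Bool using (Bool; true; false; T; not; _∧_)
import Data.Bool as Bool
open import Data.Bool.Properties using (T?)
open import Data.Fin using (Fin; zero; fromℕ; suc; toℕ; #_; _≟_; _↑ʳ_)
open import Data.Fin.Properties using (all?; any?)
open import Data.Fin.Subset using (Subset; inside; outside; _∈_; _⊆_; ∣_∣; ⁅_⁆; _∪_; _-_)
open import Data.Fin.Subset.Properties using (_∈?_; p⊆p∪q; q⊆p∪q; x∈p∪q⁻; x∈⁅x⁆; x∈⁅y⁆⇒x≡y; ∣⁅x⁆∣≡1; ∣⊤∣≡n; ∣⊥∣≡0; p⊆q⇒∣p∣≤∣q∣; x∈p⇒∣p-x∣<∣p∣; x∈p∧x≢y⇒x∈p-y)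
open import Data.List using (List; []; _∷_; length; lookup; drop)
import Data.List as List
import Data.List.Membership.Propositional as LM
open import Data.List.Membership.Propositional.Properties using (∈-map⁺; ∈-++⁺ˡ; ∈-++⁺ʳ; ∈-filter⁺; ∈-lookup)
open import Data.List.Relation.Binary.Sublist.Propositional using (from∈) renaming (_⊆_ to _⊑_; [] to []ˢ; _∷_ to _∷ˢ_; _∷ʳ_ to _∷ʳˢ_; ⊆-refl to ⊑-refl)
open import Data.List.Relation.Binary.Sublist.Propositional.Properties using (All-resp-⊆; length-mono-≤)
open import Data.List.Relation.Unary.All as All using (All; []; _∷_)
open import Data.List.Relation.Unary.AllPairs using (AllPairs; []; _∷_)
open import Data.List.Relation.Unary.Any using (here; there)
open import Data.Nat using (ℕ; zero; suc; _+_; _≤_; _<_; z≤n; s≤s)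
open import Data.Nat.Properties hiding (_≟_)
open import Data.Product using (Σ; _×_; _,_; proj₁; proj₂; ∃; ∃-syntax)
open import Data.Sum using (_⊎_; inj₁; inj₂; [_,_]′)
open import Data.Unit using (⊤; tt)
open import Data.Vec as Vec using (Vec; []; _∷_)
import Data.Vec.Properties as Vec
import Data.Vec.Relation.Unary.All as VecAll
open VecAll using ([]; _∷_)
open import Function using (_∘_)
open import Function.Bundles using (_⇔_; mk⇔; Equivalence)
open import Relation.Binary.Definitions using (tri<; tri≈; tri>)
open import Relation.Binary.PropositionalEquality using (_≡_; _≢_; refl; sym; trans; cong; subst)
open import Relation.Nullary using (¬_; Dec; yes; no; does; contradiction)
open import Relation.Nullary.Decidable using (map′; from-yes; _×-dec_; _⊎-dec_; _→-dec_; ¬?; ⌊_⌋; toWitness; True; dec-true)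

-- Lists

module _ {A : Set} where

  AllPairs-resp-⊑ : ∀ {R : A → A → Set} {xs ys} → xs ⊑ ys → AllPairs R ys → AllPairs R xs
  AllPairs-resp-⊑ []ˢ           []         = []
  AllPairs-resp-⊑ (_ ∷ʳˢ s)     (_ ∷ rs)   = AllPairs-resp-⊑ s rs
  AllPairs-resp-⊑ (refl ∷ˢ s)   (r ∷ rs)   = All-resp-⊆ s r ∷ AllPairs-resp-⊑ s rs

  AllPairs-lookup : ∀ {R : A → A → Set} {xs} → AllPairs R xs →
                    ∀ i j → toℕ i < toℕ j → R (lookup xs i) (lookup xs j)
  AllPairs-lookup {xs = _ ∷ xs} (r ∷ _) zero    (suc j) _         = All.lookup r (∈-lookup j)
  AllPairs-lookup               (_ ∷ rs) (suc i) (suc j) (s≤s i<j) = AllPairs-lookup rs i j i<j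

  order₂ : ∀ {x y : A} {xs} → x ≢ y → x LM.∈ xs → y LM.∈ xs →
           (x ∷ y ∷ [] ⊑ xs) ⊎ (y ∷ x ∷ [] ⊑ xs)
  order₂ x≢y (here refl) (here refl) = contradiction refl x≢y
  order₂ x≢y (here refl) (there q)   = inj₁ (refl ∷ˢ from∈ q)
  order₂ x≢y (there p)   (here refl) = inj₂ (refl ∷ˢ from∈ p)
  order₂ x≢y (there p)   (there q)   =
    [ inj₁ ∘ (_ ∷ʳˢ_) , inj₂ ∘ (_ ∷ʳˢ_) ]′ (order₂ x≢y p q)

  -- A path meets three vertices in an order that need not be the given one; `Q` carries their
  -- membership in the set through the permutation.
  order₃ : ∀ {Q : A → Set} {x y z : A} {xs} → x ≢ y → y ≢ z → x ≢ z → Q x → Q y → Q z →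
           x LM.∈ xs → y LM.∈ xs → z LM.∈ xs →
           ∃[ u ] ∃[ v ] ∃[ w ] (Q u × Q v × Q w × u ∷ v ∷ w ∷ [] ⊑ xs)
  order₃ x≢y y≢z x≢z qx qy qz (here refl) (here refl) _           = contradiction refl x≢y
  order₃ x≢y y≢z x≢z qx qy qz (here refl) _           (here refl) = contradiction refl x≢z
  order₃ x≢y y≢z x≢z qx qy qz _           (here refl) (here refl) = contradiction refl y≢z
  order₃ x≢y y≢z x≢z qx qy qz (here refl) (there q)   (there r) with order₂ y≢z q r
  ... | inj₁ s = _ , _ , _ , qx , qy , qz , refl ∷ˢ s
  ... | inj₂ s = _ , _ , _ , qx , qz , qy , refl ∷ˢ s
  order₃ x≢y y≢z x≢z qx qy qz (there p)   (here refl) (there r) with order₂ x≢z p r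
  ... | inj₁ s = _ , _ , _ , qy , qx , qz , refl ∷ˢ s
  ... | inj₂ s = _ , _ , _ , qy , qz , qx , refl ∷ˢ s
  order₃ x≢y y≢z x≢z qx qy qz (there p)   (there q)   (here refl) with order₂ x≢y p q
  ... | inj₁ s = _ , _ , _ , qz , qx , qy , refl ∷ˢ s
  ... | inj₂ s = _ , _ , _ , qz , qy , qx , refl ∷ˢ s
  order₃ x≢y y≢z x≢z qx qy qz (there p)   (there q)   (there r)
    with order₃ x≢y y≢z x≢z qx qy qz p q r
  ... | u , v , w , qu , qv , qw , s = u , v , w , qu , qv , qw , _ ∷ʳˢ s

  tooShort : ∀ {xs ys : List A} → length ys < length xs → ¬ xs ⊑ ys
  tooShort ys<xs s = <⇒≱ ys<xs (length-mono-≤ s)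

-- Finite subsets

∣p∪q∣≤∣p∣+∣q∣ : ∀ {n} (p q : Subset n) → ∣ p ∪ q ∣ ≤ ∣ p ∣ + ∣ q ∣
∣p∪q∣≤∣p∣+∣q∣ []            []            = z≤n
∣p∪q∣≤∣p∣+∣q∣ (outside ∷ p) (outside ∷ q) = ∣p∪q∣≤∣p∣+∣q∣ p q
∣p∪q∣≤∣p∣+∣q∣ (outside ∷ p) (inside  ∷ q) rewrite +-suc ∣ p ∣ ∣ q ∣ = s≤s (∣p∪q∣≤∣p∣+∣q∣ p q)
∣p∪q∣≤∣p∣+∣q∣ (inside  ∷ p) (outside ∷ q) = s≤s (∣p∪q∣≤∣p∣+∣q∣ p q)
∣p∪q∣≤∣p∣+∣q∣ (inside  ∷ p) (inside  ∷ q) = s≤s (≤-trans (∣p∪q∣≤∣p∣+∣q∣ p q) (+-monoʳ-≤ ∣ p ∣ (n≤1+n ∣ q ∣)))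

∣p++q∣≡∣p∣+∣q∣ : ∀ {m n} (p : Subset m) (q : Subset n) → ∣ p Vec.++ q ∣ ≡ ∣ p ∣ + ∣ q ∣
∣p++q∣≡∣p∣+∣q∣ []            q = refl
∣p++q∣≡∣p∣+∣q∣ (inside  ∷ p) q = cong suc (∣p++q∣≡∣p∣+∣q∣ p q)
∣p++q∣≡∣p∣+∣q∣ (outside ∷ p) q = ∣p++q∣≡∣p∣+∣q∣ p q

-- An explicit enumeration, so that the maximal sets of a concrete pattern are found by evaluation.
-- It also fixes the order of the tables of maximal sets.
subsets : ∀ n → List (Subset n)
subsets zero    = [] ∷ []
subsets (suc n) = List.map (inside ∷_) (subsets n) List.++ List.map (outside ∷_) (subsets n)

∈-subsets : ∀ {n} (M : Subset n) → M LM.∈ subsets n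
∈-subsets []            = here refl
∈-subsets (inside  ∷ M) = ∈-++⁺ˡ (∈-map⁺ (inside ∷_) (∈-subsets M))
∈-subsets (outside ∷ M) = ∈-++⁺ʳ _ (∈-map⁺ (outside ∷_) (∈-subsets M))

-- Walks in an arbitrary graph

module _ (G : Graph) where
  open Graph G using (n)

  -- The length bound says that skipping to position `j` saves at least `j` steps; `shortcut` turns
  -- this into a strict gain.
  suffix : ∀ {u v} (p : Walk G u v) (j : Fin (length (verts G p))) →
           Σ (Walk G (lookup (verts G p) j) v) λ q →
             verts G q ⊑ verts G p × toℕ j + len G q ≤ len G p
  suffix [ u ]         zero    = [ u ] , ⊑-refl , z≤n
  suffix (u ∷⟨ e ⟩ p)  zero    = u ∷⟨ e ⟩ p , ⊑-refl , ≤-refl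
  suffix (u ∷⟨ e ⟩ p)  (suc j) with suffix p j
  ... | q , s , l = q , u ∷ʳˢ s , s≤s l

  -- The chord replaces a stretch of at least two edges. The new walk visits a sublist of the old
  -- vertices, so distinctness is inherited.
  shortcut : ∀ {u v} (p : Walk G u v) (i j : Fin (length (verts G p))) →
             2 + toℕ i ≤ toℕ j → Adj G (lookup (verts G p) i) (lookup (verts G p) j) →
             Σ (Walk G u v) λ q → verts G q ⊑ verts G p × len G q < len G p
  shortcut [ _ ]        zero    zero    ()
  shortcut (u ∷⟨ _ ⟩ p) zero    (suc j) (s≤s 1≤j) chord with suffix p j
  ... | q , s , l = u ∷⟨ chord ⟩ q , refl ∷ˢ s , s≤s (≤-trans (+-monoˡ-≤ (len G q) 1≤j) l)
  shortcut (u ∷⟨ e ⟩ p) (suc i) (suc j) (s≤s i≤j) chord with shortcut p i j i≤j chord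
  ... | q , s , l = u ∷⟨ e ⟩ q , refl ∷ˢ s , s≤s l

  shortest⇒induced : ∀ {u v} {p : Walk G u v} → IsShortestPath G p → IsInducedPath G p
  shortest⇒induced {p = p} (path , shortest) = path , λ i j i≤j chord →
    let q , s , l = shortcut p i j i≤j chord
    in <⇒≱ l (shortest q (AllPairs-resp-⊑ s path))

  mp⇒gp : ∀ S → IsMPSet G S → IsGPSet G S
  mp⇒gp S mp p shortest = mp p (shortest⇒induced shortest)

  -- Here `drop 1` skips the successor of `x`. On an explicit vertex list the condition unfolds to
  -- finitely many non-adjacencies.
  Chordless : List (V G) → Set
  Chordless []       = ⊤
  Chordless (x ∷ xs) = All (λ y → ¬ Adj G x y) (drop 1 xs) × Chordless xs

  chordless⇒nonadjacent : ∀ {xs} → Chordless xs → ∀ i j → 2 + toℕ i ≤ toℕ j →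
                          ¬ Adj G (lookup xs i) (lookup xs j)
  chordless⇒nonadjacent {_ ∷ _ ∷ _} (c , _) zero    (suc (suc j)) _         = All.lookup c (∈-lookup j)
  chordless⇒nonadjacent {_ ∷ _ ∷ _} _       zero    (suc zero)    (s≤s ())
  chordless⇒nonadjacent {_ ∷ _}     (_ , c) (suc i) (suc j)       (s≤s i≤j) = chordless⇒nonadjacent c i j i≤j

  orderedTriple : ∀ {S u v} {p : Walk G u v} → ContainsThree G S p →
                  ∃[ x ] ∃[ y ] ∃[ z ] (x ∈ S × y ∈ S × z ∈ S × x ∷ y ∷ z ∷ [] ⊑ verts G p)
  orderedTriple {S} (_ , _ , _ , x≢y , y≢z , x≢z , xS , yS , zS , xp , yp , zp) =
    order₃ {Q = _∈ S} x≢y y≢z x≢z xS yS zS xp yp zp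

-- Necessity

  -- Deleting the three distinct vertices one after another lowers the size each time.
  three≤∣_∣ : ∀ (S : Subset n) {u v} {p : Walk G u v} → ContainsThree G S p → 3 ≤ ∣ S ∣
  three≤∣ S ∣ (x , y , z , x≢y , y≢z , x≢z , xS , yS , zS , _) = begin
    3                         ≤⟨ s≤s (s≤s (s≤s z≤n)) ⟩
    3 + ∣ ((S - x) - y) - z ∣ ≤⟨ s≤s (s≤s (x∈p⇒∣p-x∣<∣p∣ z∈)) ⟩
    2 + ∣ (S - x) - y ∣       ≤⟨ s≤s (x∈p⇒∣p-x∣<∣p∣ y∈) ⟩
    1 + ∣ S - x ∣             ≤⟨ x∈p⇒∣p-x∣<∣p∣ xS ⟩
    ∣ S ∣                     ∎
    where
    open ≤-Reasoning
    y∈ : y ∈ S - x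
    y∈ = x∈p∧x≢y⇒x∈p-y yS (x≢y ∘ sym)
    z∈ : z ∈ (S - x) - y
    z∈ = x∈p∧x≢y⇒x∈p-y (x∈p∧x≢y⇒x∈p-y zS (x≢z ∘ sym)) (y≢z ∘ sym)

  ∣S∣≤2⇒mp : ∀ S → ∣ S ∣ ≤ 2 → IsMPSet G S
  ∣S∣≤2⇒mp S ∣S∣≤2 p _ three = <⇒≱ (three≤∣ S ∣ three) ∣S∣≤2

  gp⁻≤2⇒mp⁻≤gp⁻ : ∀ {a b} → MpMinus G a → GpMinus G b → b ≤ 2 → a ≤ b
  gp⁻≤2⇒mp⁻≤gp⁻ (_ , mp-min) ((S , (_ , S-max) , refl) , _) b≤2 =
    mp-min S (∣S∣≤2⇒mp S b≤2 , λ T mp → S-max T (mp⇒gp T mp))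

  mp⁻≤1⇒gp⁻≤mp⁻ : ∀ {a b} → MpMinus G a → GpMinus G b → a ≤ 1 → b ≤ a
  mp⁻≤1⇒gp⁻≤mp⁻ ((S , (_ , S-max) , refl) , _) ((R , _ , refl) , _) a≤1 =
    p⊆q⇒∣p∣≤∣q∣ {p = R} {S} λ {x} _ → full x
    where
    full : ∀ x → x ∈ S
    -- With `x` added the set still has at most two vertices, hence is in monophonic position, so
    -- maximality already puts `x` in `S`.
    full x = S-max (S ∪ ⁅ x ⁆) (∣S∣≤2⇒mp (S ∪ ⁅ x ⁆) ∣S∪x∣≤2) (p⊆p∪q ⁅ x ⁆) (q⊆p∪q S ⁅ x ⁆ (x∈⁅x⁆ x))
      where
      ∣S∪x∣≤2 : ∣ S ∪ ⁅ x ⁆ ∣ ≤ 2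
      ∣S∪x∣≤2 = ≤-trans (∣p∪q∣≤∣p∣+∣q∣ S ⁅ x ⁆) (+-mono-≤ a≤1 (≤-reflexive (∣⁅x⁆∣≡1 x)))

-- Blow-ups

-- `near` is adjacency or equality, so that two distinct vertices of the blow-up are
-- adjacent exactly if their classes are near.
module Induced {m : ℕ} (near : Fin m → Fin m → Bool) where

  Near : Fin m → Fin m → Set
  Near a b = T (near a b)

  -- Distinctness is implicit: if `b` equals `a` or `c`, one of the two nearness conditions becomes
  -- `Near a c`, and reflexivity separates `a` from `c`. Hence two vertices of one class never take
  -- part in such a triple together.
  InducedP₃ : (a b c : Fin m) → Set
  InducedP₃ a b c = Near a b × Near b c × ¬ Near a c

  InducedP₄ : (a b c d : Fin m) → Set
  InducedP₄ a b c d = InducedP₃ a b c × InducedP₃ b c d × ¬ Near a d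

  InducedP₅ : (a b c d e : Fin m) → Set
  InducedP₅ a b c d e = InducedP₄ a b c d × InducedP₄ b c d e × ¬ Near a e

  -- Three vertices of an induced path on four vertices either are consecutive or miss an inner
  -- vertex, which up to reversal is the third. Longer induced paths are excluded by `P₅-free`.
  OnInducedPath : (a b c : Fin m) → Set
  OnInducedPath a b c = InducedP₃ a b c ⊎ ∃ λ d → InducedP₄ a b d c

  Near? : ∀ a b → Dec (Near a b)
  Near? a b = T? (near a b)

  InducedP₃? : ∀ a b c → Dec (InducedP₃ a b c)
  InducedP₃? a b c = Near? a b ×-dec Near? b c ×-dec ¬? (Near? a c)

  InducedP₄? : ∀ a b c d → Dec (InducedP₄ a b c d)
  InducedP₄? a b c d = InducedP₃? a b c ×-dec InducedP₃? b c d ×-dec ¬? (Near? a d)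

  InducedP₅? : ∀ a b c d e → Dec (InducedP₅ a b c d e)
  InducedP₅? a b c d e = InducedP₄? a b c d ×-dec InducedP₄? b c d e ×-dec ¬? (Near? a e)

  OnInducedPath? : ∀ a b c → Dec (OnInducedPath a b c)
  OnInducedPath? a b c = InducedP₃? a b c ⊎-dec any? λ d → InducedP₄? a b d c

-- The hub gives the blow-up diameter at most 2, and `P₅-free` leaves only induced paths on at most
-- four vertices. Both position conditions thereby become conditions on triples of classes.
record IsPattern {m : ℕ} (near : Fin m → Fin m → Bool) (hub : Fin m) : Set where
  open Induced near public
  field
    near-refl : ∀ a → Near a a
    near-sym  : ∀ a b → near a b ≡ near b a
    near-hub  : ∀ a → Near a hub
    P₅-free   : ∀ a b c d e → ¬ InducedP₅ a b c d e

  Near-sym : ∀ {a b} → Near a b → Near b a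
  Near-sym {a} {b} = subst T (near-sym a b)

  InducedP₃-sym : ∀ {a b c} → InducedP₃ a b c → InducedP₃ c b a
  InducedP₃-sym (ab , bc , ¬ac) = Near-sym bc , Near-sym ab , ¬ac ∘ Near-sym

  InducedP₄-sym : ∀ {a b c d} → InducedP₄ a b c d → InducedP₄ d c b a
  InducedP₄-sym (abc , bcd , ¬ad) = InducedP₃-sym bcd , InducedP₃-sym abc , ¬ad ∘ Near-sym

-- Sets without forbidden triples

module _ {m : ℕ} (F : Fin m → Fin m → Fin m → Set) where

  Free : Subset m → Set
  Free M = ∀ a → a ∈ M → ∀ b → b ∈ M → ∀ c → c ∈ M → ¬ F a b c

  -- Testing one-element extensions suffices, since freeness passes to subsets.
  MaximalFree : Subset m → Set
  MaximalFree M = Free M × (∀ d → ¬ d ∈ M → ¬ Free (M ∪ ⁅ d ⁆))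

  module _ (F? : ∀ a b c → Dec (F a b c)) where

    Free? : ∀ M → Dec (Free M)
    Free? M = all? λ a → (a ∈? M) →-dec all? λ b → (b ∈? M) →-dec
              all? λ c → (c ∈? M) →-dec ¬? (F? a b c)

    MaximalFree? : ∀ M → Dec (MaximalFree M)
    MaximalFree? M = Free? M ×-dec all? λ d → ¬? (d ∈? M) →-dec ¬? (Free? (M ∪ ⁅ d ⁆))

    maximalFrees : List (Subset m)
    maximalFrees = List.filter MaximalFree? (subsets m)

weight : ∀ {m} → Subset m → Vec ℕ m → ℕ
weight []            []      = 0
weight (inside  ∷ M) (k ∷ w) = k + weight M w
weight (outside ∷ M) (_ ∷ w) = weight M w

lookup≤weight : ∀ {m} {M : Subset m} {w c} → c ∈ M → Vec.lookup w c ≤ weight M w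
lookup≤weight {M = inside  ∷ M} {k ∷ w} Vec.here       = m≤m+n k (weight M w)
lookup≤weight {M = inside  ∷ M} {k ∷ w} (Vec.there c∈) = ≤-trans (lookup≤weight c∈) (m≤n+m (weight M w) k)
lookup≤weight {M = outside ∷ M} {k ∷ w} (Vec.there c∈) = lookup≤weight c∈

-- A record rather than a synonym, so that M can be inferred from a goal.
record WeighsAtLeast {m} (w : Vec ℕ m) (k : ℕ) (M : Subset m) : Set where
  constructor ⟨_⟩
  field k≤weight : k ≤ weight M w

-- One heavy class inside `M` already pays for the whole bound.
byClass : ∀ {m k} {M : Subset m} {w} c {c∈M : True (c ∈? M)} → k ≤ Vec.lookup w c → WeighsAtLeast w k M
byClass c {c∈M} k≤ = ⟨ ≤-trans k≤ (lookup≤weight (toWitness c∈M)) ⟩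

-- Entry `v` is the class of vertex `v`; the vertices are listed class by class.
classes : ∀ {m} (w : Vec ℕ m) → Vec (Fin m) (Vec.sum w)
classes []      = []
classes (k ∷ w) = Vec.replicate k zero Vec.++ Vec.map suc (classes w)

∣preimage∣≡weight : ∀ {m} (M : Subset m) (w : Vec ℕ m) →
                    ∣ Vec.map (Vec.lookup M) (classes w) ∣ ≡ weight M w
∣preimage∣≡weight []      []      = refl
∣preimage∣≡weight (s ∷ M) (k ∷ w)
  rewrite Vec.map-++ (Vec.lookup (s ∷ M)) (Vec.replicate k zero) (Vec.map suc (classes w))
        | ∣p++q∣≡∣p∣+∣q∣ (Vec.map (Vec.lookup (s ∷ M)) (Vec.replicate k zero)) (Vec.map (Vec.lookup (s ∷ M)) (Vec.map suc (classes w)))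
        | Vec.map-replicate (Vec.lookup (s ∷ M)) (zero {n = _}) k
        | sym (Vec.map-∘ (Vec.lookup (s ∷ M)) suc (classes w))
        | ∣preimage∣≡weight M w with s
... | inside  = cong (_+ weight M w) (∣⊤∣≡n k)
... | outside = cong (_+ weight M w) (∣⊥∣≡0 k)

classes-surjective : ∀ {m} {w : Vec ℕ m} → VecAll.All (1 ≤_) w → ∀ c → ∃[ v ] Vec.lookup (classes w) v ≡ c
classes-surjective (s≤s _ ∷ _) zero = zero , refl
classes-surjective {w = k ∷ w} (_ ∷ pos) (suc c) with classes-surjective pos c
... | v , refl = k ↑ʳ v , trans (Vec.lookup-++ʳ (Vec.replicate k zero) (Vec.map suc (classes w)) v)
                                (Vec.lookup-map v suc (classes w))

-- The blow-up graph and its position sets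

module BlowUp {size : ℕ} {near : Fin size → Fin size → Bool} {hub : Fin size} (H : IsPattern near hub)
              (w : Vec ℕ size) (w≥1 : VecAll.All (1 ≤_) w) where
  open IsPattern H

  private
    Vertex : Set
    Vertex = Fin (Vec.sum w)

  π : Vertex → Fin size
  π = Vec.lookup (classes w)

  π-surjective : ∀ c → ∃[ v ] π v ≡ c
  π-surjective = classes-surjective w≥1

  G : Graph
  G = record
    { n      = Vec.sum w
    ; adj    = λ u v → not ⌊ u ≟ v ⌋ ∧ near (π u) (π v)
    ; sym    = adj-sym
    ; irrefl = adj-irrefl
    }
    where
    adj-sym : ∀ u v → not ⌊ u ≟ v ⌋ ∧ near (π u) (π v) ≡ not ⌊ v ≟ u ⌋ ∧ near (π v) (π u)
    adj-sym u v with u ≟ v | v ≟ u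
    ... | yes _   | yes _   = refl
    ... | yes u≡v | no v≢u  = contradiction (sym u≡v) v≢u
    ... | no u≢v  | yes v≡u = contradiction (sym v≡u) u≢v
    ... | no _    | no _    = near-sym (π u) (π v)
    adj-irrefl : ∀ u → not ⌊ u ≟ u ⌋ ∧ near (π u) (π u) ≡ false
    adj-irrefl u with u ≟ u
    ... | yes _  = refl
    ... | no u≢u = contradiction refl u≢u

  adj⇒near : ∀ {u v} → Adj G u v → Near (π u) (π v)
  adj⇒near {u} {v} uv with u ≟ v
  ... | no _ = uv

  near⇒adj : ∀ {u v} → u ≢ v → Near (π u) (π v) → Adj G u v
  near⇒adj {u} {v} u≢v uv with u ≟ v
  ... | yes u≡v = contradiction u≡v u≢v
  ... | no _    = uv

  far⇒≢ : ∀ {u v} → ¬ Near (π u) (π v) → u ≢ v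
  far⇒≢ {u} far refl = far (near-refl (π u))

  P₃⇒≢ˡ : ∀ {x y z} → InducedP₃ (π x) (π y) (π z) → x ≢ y
  P₃⇒≢ˡ (_ , yz , ¬xz) refl = ¬xz yz

  P₃⇒≢ʳ : ∀ {x y z} → InducedP₃ (π x) (π y) (π z) → y ≢ z
  P₃⇒≢ʳ (xy , _ , ¬xz) refl = ¬xz xy

  P₃-walk : ∀ {x y z} → InducedP₃ (π x) (π y) (π z) → Walk G x z
  P₃-walk {x} {y} {z} p₃@(xy , yz , _) =
    x ∷⟨ near⇒adj (P₃⇒≢ˡ p₃) xy ⟩ (y ∷⟨ near⇒adj (P₃⇒≢ʳ p₃) yz ⟩ [ z ])

  P₃-isPath : ∀ {x y z} (p₃ : InducedP₃ (π x) (π y) (π z)) → IsPath G (P₃-walk p₃)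
  P₃-isPath p₃@(_ , _ , ¬xz) = (P₃⇒≢ˡ p₃ ∷ far⇒≢ ¬xz ∷ []) ∷ (P₃⇒≢ʳ p₃ ∷ []) ∷ [] ∷ []

  P₃-isInduced : ∀ {x y z} (p₃ : InducedP₃ (π x) (π y) (π z)) → IsInducedPath G (P₃-walk p₃)
  P₃-isInduced p₃@(_ , _ , ¬xz) = P₃-isPath p₃ ,
    chordless⇒nonadjacent G ((¬xz ∘ adj⇒near ∷ []) , [] , [] , tt)

  P₃-isShortest : ∀ {x y z} (p₃ : InducedP₃ (π x) (π y) (π z)) → IsShortestPath G (P₃-walk p₃)
  P₃-isShortest {x} {y} {z} p₃@(_ , _ , ¬xz) = P₃-isPath p₃ , shortest
    where
    shortest : (q : Walk G x z) → IsPath G q → 2 ≤ len G q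
    shortest [ _ ]                    _ = contradiction refl (far⇒≢ ¬xz)
    shortest (_ ∷⟨ e ⟩ [ _ ])         _ = contradiction (adj⇒near e) ¬xz
    shortest (_ ∷⟨ _ ⟩ (_ ∷⟨ _ ⟩ _)) _ = s≤s (s≤s z≤n)

  P₃-three : ∀ {S x y z} → x ∈ S → y ∈ S → z ∈ S →
             (p₃ : InducedP₃ (π x) (π y) (π z)) → ContainsThree G S (P₃-walk p₃)
  P₃-three xS yS zS p₃@(_ , _ , ¬xz) = _ , _ , _ , P₃⇒≢ˡ p₃ , P₃⇒≢ʳ p₃ , far⇒≢ ¬xz ,
    xS , yS , zS , here refl , there (here refl) , there (there (here refl))

  shortWalk : ∀ u v → Σ (Walk G u v) λ p → IsPath G p × len G p ≤ 2
  shortWalk u v with u ≟ v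
  ... | yes refl = [ u ] , [] ∷ [] , z≤n
  ... | no u≢v with Near? (π u) (π v)
  ...   | yes uv = u ∷⟨ near⇒adj u≢v uv ⟩ [ v ] , (u≢v ∷ []) ∷ [] ∷ [] , s≤s z≤n
  -- Far vertices are joined through the hub class, which is nonempty because all weights are
  -- positive.
  ...   | no ¬uv with π-surjective hub
  ...     | h , πh≡hub = P₃-walk p₃ , P₃-isPath p₃ , ≤-refl
    where
    p₃ : InducedP₃ (π u) (π h) (π v)
    p₃ = subst (Near (π u)) (sym πh≡hub) (near-hub (π u))
       , Near-sym (subst (Near (π v)) (sym πh≡hub) (near-hub (π v)))
       , ¬uv

  connected : Connected G
  connected u v = proj₁ (shortWalk u v)

  PullsBack : (Subset (Vec.sum w) → Set) → (Fin size → Fin size → Fin size → Set) → Set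
  PullsBack P F = ∀ S → P S ⇔ (∀ x y z → x ∈ S → y ∈ S → z ∈ S → ¬ F (π x) (π y) (π z))

  FarApart : List Vertex → Set
  FarApart xs = ∀ i j → 2 + toℕ i ≤ toℕ j → ¬ Near (π (lookup xs i)) (π (lookup xs j))

  -- Near classes allow equality as well as adjacency of the two vertices; a path repeats no vertex,
  -- so only the excluded adjacency remains.
  induced⇒farApart : ∀ {u v} (p : Walk G u v) → IsInducedPath G p → FarApart (verts G p)
  induced⇒farApart p (path , nonadj) i j i≤j ij =
    nonadj i j i≤j (near⇒adj (AllPairs-lookup path i j (≤-trans (n≤1+n _) i≤j)) ij)

  farApart-∷ : ∀ {x xs} → FarApart (x ∷ xs) → FarApart xs
  farApart-∷ far i j i≤j = far (suc i) (suc j) (s≤s i≤j)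

  farApart⇒P₃ : ∀ {x y z xs} → Adj G x y → Adj G y z → FarApart (x ∷ y ∷ z ∷ xs) →
                InducedP₃ (π x) (π y) (π z)
  farApart⇒P₃ xy yz far = adj⇒near xy , adj⇒near yz , far zero (suc (suc zero)) (s≤s (s≤s z≤n))

  farApart⇒P₄ : ∀ {x y z t xs} → Adj G x y → Adj G y z → Adj G z t →
                FarApart (x ∷ y ∷ z ∷ t ∷ xs) → InducedP₄ (π x) (π y) (π z) (π t)
  farApart⇒P₄ xy yz zt far = farApart⇒P₃ xy yz far , farApart⇒P₃ yz zt (farApart-∷ far) ,
    far zero (suc (suc (suc zero))) (s≤s (s≤s z≤n))

  farApart⇒P₅ : ∀ {x y z t s xs} → Adj G x y → Adj G y z → Adj G z t → Adj G t s →
                FarApart (x ∷ y ∷ z ∷ t ∷ s ∷ xs) → InducedP₅ (π x) (π y) (π z) (π t) (π s)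
  farApart⇒P₅ xy yz zt ts far = farApart⇒P₄ xy yz zt far , farApart⇒P₄ yz zt ts (farApart-∷ far) ,
    far zero (suc (suc (suc (suc zero)))) (s≤s (s≤s z≤n))

  -- Shortest paths have at most three vertices here, so one with three vertices of `S` is an
  -- induced path on exactly these. Conversely, every induced path on three vertices is shortest,
  -- its ends being distinct and non-adjacent.
  gp-pullsBack : PullsBack (IsGPSet G) InducedP₃
  gp-pullsBack S = mk⇔ to from
    where
    to : IsGPSet G S → ∀ x y z → x ∈ S → y ∈ S → z ∈ S → ¬ InducedP₃ (π x) (π y) (π z)
    to gp x y z xS yS zS p₃ = gp (P₃-walk p₃) (P₃-isShortest p₃) (P₃-three xS yS zS p₃)

    from : (∀ x y z → x ∈ S → y ∈ S → z ∈ S → ¬ InducedP₃ (π x) (π y) (π z)) → IsGPSet G S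
    from free {u} {v} p shortest three with orderedTriple G {p = p} three
    ... | _ , _ , _ , xS , yS , zS , s =
      -- Comparison with the path from `shortWalk` bounds the length of `p` by 2.
      go p (shortest⇒induced G shortest) s (≤-trans (proj₂ shortest q q-path) q≤2)
      where
      q = proj₁ (shortWalk u v)
      q-path = proj₁ (proj₂ (shortWalk u v))
      q≤2 = proj₂ (proj₂ (shortWalk u v))
      go : ∀ {u v} (p : Walk G u v) → IsInducedPath G p → _ ∷ _ ∷ _ ∷ [] ⊑ verts G p → ¬ len G p ≤ 2
      go [ _ ] _ s _ = tooShort (s≤s (s≤s z≤n)) s
      go (_ ∷⟨ _ ⟩ [ _ ]) _ s _ = tooShort ≤-refl s
      go p@(x ∷⟨ xy ⟩ (y ∷⟨ yz ⟩ [ z ])) ind s _ with s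
      ... | refl ∷ˢ refl ∷ˢ refl ∷ˢ []ˢ = free x y z xS yS zS (farApart⇒P₃ xy yz (induced⇒farApart p ind))
      ... | refl ∷ˢ (_ ∷ʳˢ s)           = tooShort ≤-refl s
      ... | _ ∷ʳˢ s                     = tooShort ≤-refl s
      go (_ ∷⟨ _ ⟩ (_ ∷⟨ _ ⟩ (_ ∷⟨ _ ⟩ _))) _ _ (s≤s (s≤s ()))

  P₄-walk : ∀ {x y t z} → InducedP₄ (π x) (π y) (π t) (π z) → Walk G x z
  P₄-walk {x} (p₃@(xy , _) , p₃′ , _) = x ∷⟨ near⇒adj (P₃⇒≢ˡ p₃) xy ⟩ P₃-walk p₃′

  P₄-isInduced : ∀ {x y t z} (p₄ : InducedP₄ (π x) (π y) (π t) (π z)) → IsInducedPath G (P₄-walk p₄)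
  P₄-isInduced (p₃@(_ , _ , ¬xt) , p₃′@(_ , _ , ¬yz) , ¬xz) =
    (P₃⇒≢ˡ p₃ ∷ far⇒≢ ¬xt ∷ far⇒≢ ¬xz ∷ []) ∷ P₃-isPath p₃′ ,
    chordless⇒nonadjacent G ((¬xt ∘ adj⇒near ∷ ¬xz ∘ adj⇒near ∷ []) , (¬yz ∘ adj⇒near ∷ []) , [] , [] , tt)

  -- An induced path with three vertices of `S` has three or four vertices, since the first five
  -- vertices of a longer one would form an induced P₅. The cases record which vertex of the path is
  -- left out.
  mp-pullsBack : PullsBack (IsMPSet G) OnInducedPath
  mp-pullsBack S = mk⇔ to from
    where
    to : IsMPSet G S → ∀ x y z → x ∈ S → y ∈ S → z ∈ S → ¬ OnInducedPath (π x) (π y) (π z)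
    to mp x y z xS yS zS (inj₁ p₃) = mp (P₃-walk p₃) (P₃-isInduced p₃) (P₃-three xS yS zS p₃)
    to mp x y z xS yS zS (inj₂ (d , p₄)) with π-surjective d
    to mp x y z xS yS zS (inj₂ (_ , p₄@(p₃ , (_ , _ , ¬yz) , ¬xz))) | t , refl =
      mp (P₄-walk p₄) (P₄-isInduced p₄)
        (x , y , z , P₃⇒≢ˡ p₃ , far⇒≢ ¬yz , far⇒≢ ¬xz , xS , yS , zS ,
         here refl , there (here refl) , there (there (there (here refl))))

    from : (∀ x y z → x ∈ S → y ∈ S → z ∈ S → ¬ OnInducedPath (π x) (π y) (π z)) → IsMPSet G S
    from free p induced three with orderedTriple G {p = p} three
    ... | _ , _ , _ , xS , yS , zS , s = go p induced s
      where
      go : ∀ {u v} (p : Walk G u v) → IsInducedPath G p → ¬ (_ ∷ _ ∷ _ ∷ [] ⊑ verts G p)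
      go [ _ ] _ s = tooShort (s≤s (s≤s z≤n)) s
      go (_ ∷⟨ _ ⟩ [ _ ]) _ s = tooShort ≤-refl s
      go p@(x ∷⟨ xy ⟩ (y ∷⟨ yz ⟩ [ z ])) ind s with s
      ... | refl ∷ˢ refl ∷ˢ refl ∷ˢ []ˢ = free x y z xS yS zS (inj₁ (farApart⇒P₃ xy yz (induced⇒farApart p ind)))
      ... | refl ∷ˢ (_ ∷ʳˢ s)           = tooShort ≤-refl s
      ... | _ ∷ʳˢ s                     = tooShort ≤-refl s
      go p@(x ∷⟨ xy ⟩ (y ∷⟨ yz ⟩ (z ∷⟨ zt ⟩ [ t ]))) ind s
        with farApart⇒P₄ xy yz zt (induced⇒farApart p ind) | s
      ... | p₃ , _        | refl ∷ˢ refl ∷ˢ refl ∷ˢ _ ∷ʳˢ []ˢ   = free x y z xS yS zS (inj₁ p₃)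
      ... | p₄            | refl ∷ˢ refl ∷ˢ _ ∷ʳˢ refl ∷ˢ []ˢ   = free x y t xS yS zS (inj₂ (π z , p₄))
      -- The second vertex is left out, so the path is read backwards to make it the third.
      ... | p₄            | refl ∷ˢ _ ∷ʳˢ refl ∷ˢ refl ∷ˢ []ˢ   = free t z x zS yS xS (inj₂ (π y , InducedP₄-sym p₄))
      ... | _ , p₃ , _    | _ ∷ʳˢ refl ∷ˢ refl ∷ˢ refl ∷ˢ []ˢ   = free y z t xS yS zS (inj₁ p₃)
      ... | _             | refl ∷ˢ refl ∷ˢ _ ∷ʳˢ _ ∷ʳˢ s       = tooShort ≤-refl s
      ... | _             | refl ∷ˢ _ ∷ʳˢ refl ∷ˢ _ ∷ʳˢ s       = tooShort ≤-refl s
      ... | _             | refl ∷ˢ _ ∷ʳˢ _ ∷ʳˢ s               = tooShort ≤-refl s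
      ... | _             | _ ∷ʳˢ refl ∷ˢ _ ∷ʳˢ s               = tooShort ≤-refl s
      ... | _             | _ ∷ʳˢ _ ∷ʳˢ s                       = tooShort ≤-refl s
      go p@(x ∷⟨ xy ⟩ (y ∷⟨ yz ⟩ (z ∷⟨ zt ⟩ (t ∷⟨ ts ⟩ [ _ ])))) ind _ =
        P₅-free _ _ _ _ _ (farApart⇒P₅ xy yz zt ts (induced⇒farApart p ind))
      go p@(x ∷⟨ xy ⟩ (y ∷⟨ yz ⟩ (z ∷⟨ zt ⟩ (t ∷⟨ ts ⟩ (_ ∷⟨ _ ⟩ _))))) ind _ =
        P₅-free _ _ _ _ _ (farApart⇒P₅ xy yz zt ts (induced⇒farApart p ind))

  preimage : Subset size → Subset (Vec.sum w)
  preimage M = Vec.map (Vec.lookup M) (classes w)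

  ∈-preimage⁺ : ∀ {M x} → π x ∈ M → x ∈ preimage M
  ∈-preimage⁺ {M} {x} πx∈M = Vec.lookup⇒[]= x (preimage M)
    (trans (Vec.lookup-map x (Vec.lookup M) (classes w)) (Vec.[]=⇒lookup πx∈M))

  ∈-preimage⁻ : ∀ {M x} → x ∈ preimage M → π x ∈ M
  ∈-preimage⁻ {M} {x} x∈ = Vec.lookup⇒[]= (π x) M
    (trans (sym (Vec.lookup-map x (Vec.lookup M) (classes w))) (Vec.[]=⇒lookup x∈))

  private
    hit? : ∀ S c → Dec (∃ λ x → x ∈ S × π x ≡ c)
    hit? S c = any? λ x → (x ∈? S) ×-dec (π x ≟ c)

  image : Subset (Vec.sum w) → Subset size
  image S = Vec.tabulate λ c → does (hit? S c)

  ∈-image⁺ : ∀ {S x} → x ∈ S → π x ∈ image S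
  ∈-image⁺ {S} {x} xS = Vec.lookup⇒[]= (π x) (image S)
    (trans (Vec.lookup∘tabulate _ (π x)) (dec-true (hit? S (π x)) (x , xS , refl)))

  ∈-image⁻ : ∀ {S c} → c ∈ image S → ∃ λ x → x ∈ S × π x ≡ c
  ∈-image⁻ {S} {c} c∈ with hit? S c | trans (sym (Vec.lookup∘tabulate (λ c → does (hit? S c)) c)) (Vec.[]=⇒lookup c∈)
  ... | yes h | _ = h

  -- Transfer of maximal sets between pattern and blow-up

  module _ {P F} (F? : ∀ a b c → Dec (F a b c)) (pullsBack : PullsBack P F) where

    private
      module P⇔ S = Equivalence (pullsBack S)

    -- One representative in `S` for each class of `M` is enough, because `F` only sees classes.
    represented⇒free : ∀ {S M} → P S → (∀ c → c ∈ M → ∃ λ x → x ∈ S × π x ≡ c) → Free F M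
    represented⇒free {S} pS rep a aM b bM c cM f with rep a aM | rep b bM | rep c cM
    ... | x , xS , refl | y , yS , refl | z , zS , refl = P⇔.to S pS x y z xS yS zS f

    preimage-P : ∀ {M} → Free F M → P (preimage M)
    preimage-P {M} free = P⇔.from (preimage M) λ x y z xM yM zM →
      free (π x) (∈-preimage⁻ xM) (π y) (∈-preimage⁻ yM) (π z) (∈-preimage⁻ zM)

    preimage-maximal : ∀ {M} → MaximalFree F M → IsMaximal G P (preimage M)
    preimage-maximal {M} (free , max) = preimage-P free , λ T pT M⊆T {x} xT → ∈-preimage⁺ (inM T pT M⊆T x xT)
      where
      inM : ∀ T → P T → preimage M ⊆ T → ∀ x → x ∈ T → π x ∈ M
      inM T pT M⊆T x xT with π x ∈? M
      ... | yes πx∈M = πx∈M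
      ... | no  πx∉M = contradiction (represented⇒free pT rep) (max (π x) πx∉M)
        where
        -- The single vertex `x` represents its class; the classes of `M` have representatives in
        -- `T` because `T` contains the preimage.
        rep : ∀ c → c ∈ M ∪ ⁅ π x ⁆ → ∃ λ y → y ∈ T × π y ≡ c
        rep c c∈ with x∈p∪q⁻ M ⁅ π x ⁆ c∈
        ... | inj₂ c∈x = x , xT , sym (x∈⁅y⁆⇒x≡y (π x) c∈x)
        ... | inj₁ c∈M with π-surjective c
        ...   | y , refl = y , M⊆T (∈-preimage⁺ c∈M) , refl

    -- If the image could be enlarged by `d`, the preimage of the enlarged set would contain `S` and
    -- satisfy `P`, so maximality of `S` would already give a vertex of class `d` in `S`.
    image-maximal : ∀ {S} → IsMaximal G P S → MaximalFree F (image S)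
    image-maximal {S} (pS , max) = represented⇒free pS (λ c → ∈-image⁻) , λ d d∉ free → d∉ (inImage d free)
      where
      inImage : ∀ d → Free F (image S ∪ ⁅ d ⁆) → d ∈ image S
      inImage d free with π-surjective d
      ... | y , refl = ∈-image⁺ (max (preimage (image S ∪ ⁅ d ⁆)) (preimage-P free)
              (λ xS → ∈-preimage⁺ (p⊆p∪q ⁅ d ⁆ (∈-image⁺ xS)))
              (∈-preimage⁺ (q⊆p∪q (image S) ⁅ d ⁆ (x∈⁅x⁆ d))))

    -- The preimage of the image of `S` contains `S` and satisfies `P`, so by maximality it lies in
    -- `S`: a maximal set is a union of whole classes.
    weight-image≤ : ∀ {S} → IsMaximal G P S → weight (image S) w ≤ ∣ S ∣
    weight-image≤ {S} S-max@(_ , max) = subst (_≤ ∣ S ∣) (∣preimage∣≡weight (image S) w)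
      (p⊆q⇒∣p∣≤∣q∣ (max (preimage (image S)) (preimage-P (proj₁ (image-maximal S-max)))
                        (λ xS → ∈-preimage⁺ (∈-image⁺ xS))))

    -- Reduces the minimum to a finite check: `M` attains it, and the image of any maximal set
    -- occurs in `maximalFrees`, where the bound is verified entry by entry.
    minMaximalSize : ∀ {k} M → True (MaximalFree? F F? M) → weight M w ≡ k →
                     All (WeighsAtLeast w k) (maximalFrees F F?) → IsMinMaximalSize G P k
    minMaximalSize M M-max weight≡k k≤ =
      (preimage M , preimage-maximal (toWitness M-max) , trans (∣preimage∣≡weight M w) weight≡k) ,
      λ S S-max → ≤-trans
        (WeighsAtLeast.k≤weight (All.lookup k≤ (∈-filter⁺ (MaximalFree? F F?) (∈-subsets (image S)) (image-maximal S-max))))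
        (weight-image≤ S-max)

-- Base patterns

isPattern? : ∀ {m} (near : Fin m → Fin m → Bool) (hub : Fin m) → Dec (IsPattern near hub)
isPattern? near hub =
  map′ (λ (r , s , h , f) → record { near-refl = r ; near-sym = s ; near-hub = h ; P₅-free = f })
       (λ H → let open IsPattern H in near-refl , near-sym , near-hub , P₅-free)
       ( all? (λ a → Near? a a)
   ×-dec all? (λ a → all? λ b → near a b Bool.≟ near b a)
   ×-dec all? (λ a → Near? a hub)
   ×-dec all? (λ a → all? λ b → all? λ c → all? λ d → all? λ e → ¬? (InducedP₅? a b c d e)))
  where open Induced near

private
  pattern ● = true
  pattern ○ = false

  fromTable : ∀ {m} → Vec (Vec Bool m) m → Fin m → Fin m → Bool
  fromTable rows a b = Vec.lookup (Vec.lookup rows a) b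

  nearPoint : Fin 1 → Fin 1 → Bool
  nearPoint = fromTable ((● ∷ []) ∷ [])

  -- The classes are p₀, p₁, p₂, p₃ and the dominating vertex.
  nearGem : Fin 5 → Fin 5 → Bool
  nearGem = fromTable
    ( (● ∷ ● ∷ ○ ∷ ○ ∷ ● ∷ [])
    ∷ (● ∷ ● ∷ ● ∷ ○ ∷ ● ∷ [])
    ∷ (○ ∷ ● ∷ ● ∷ ● ∷ ● ∷ [])
    ∷ (○ ∷ ○ ∷ ● ∷ ● ∷ ● ∷ [])
    ∷ (● ∷ ● ∷ ● ∷ ● ∷ ● ∷ [])
    ∷ [] )

  -- The classes are p₀, p₁, p₂, p₃, c and the dominating vertex.
  nearBull∨K₁ : Fin 6 → Fin 6 → Bool
  nearBull∨K₁ = fromTable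
    ( (● ∷ ● ∷ ○ ∷ ○ ∷ ○ ∷ ● ∷ [])
    ∷ (● ∷ ● ∷ ● ∷ ○ ∷ ● ∷ ● ∷ [])
    ∷ (○ ∷ ● ∷ ● ∷ ● ∷ ● ∷ ● ∷ [])
    ∷ (○ ∷ ○ ∷ ● ∷ ● ∷ ○ ∷ ● ∷ [])
    ∷ (○ ∷ ● ∷ ● ∷ ○ ∷ ● ∷ ● ∷ [])
    ∷ (● ∷ ● ∷ ● ∷ ● ∷ ● ∷ ● ∷ [])
    ∷ [] )

point : IsPattern nearPoint zero
point = from-yes (isPattern? nearPoint zero)

gem : IsPattern nearGem (fromℕ 4)
gem = from-yes (isPattern? nearGem (fromℕ 4))

bull∨K₁ : IsPattern nearBull∨K₁ (fromℕ 5)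
bull∨K₁ = from-yes (isPattern? nearBull∨K₁ (fromℕ 5))

-- Writing out the computed list lets the lower bound be given as one inequality per maximal set, by
-- `subst` along this equation. The same holds for the three tables that follow.
gem-mp : let open IsPattern gem in
         maximalFrees OnInducedPath OnInducedPath? ≡
           (● ∷ ● ∷ ○ ∷ ○ ∷ ● ∷ []) ∷ (● ∷ ○ ∷ ● ∷ ○ ∷ ○ ∷ []) ∷ (● ∷ ○ ∷ ○ ∷ ● ∷ ○ ∷ []) ∷
           (○ ∷ ● ∷ ● ∷ ○ ∷ ● ∷ []) ∷ (○ ∷ ● ∷ ○ ∷ ● ∷ ○ ∷ []) ∷ (○ ∷ ○ ∷ ● ∷ ● ∷ ● ∷ []) ∷ []
gem-mp = refl

gem-gp : let open IsPattern gem in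
         maximalFrees InducedP₃ InducedP₃? ≡
           (● ∷ ● ∷ ○ ∷ ● ∷ ○ ∷ []) ∷ (● ∷ ● ∷ ○ ∷ ○ ∷ ● ∷ []) ∷ (● ∷ ○ ∷ ● ∷ ● ∷ ○ ∷ []) ∷
           (○ ∷ ● ∷ ● ∷ ○ ∷ ● ∷ []) ∷ (○ ∷ ○ ∷ ● ∷ ● ∷ ● ∷ []) ∷ []
gem-gp = refl

bull∨K₁-mp : let open IsPattern bull∨K₁ in
             maximalFrees OnInducedPath OnInducedPath? ≡
               (● ∷ ● ∷ ○ ∷ ○ ∷ ○ ∷ ● ∷ []) ∷ (● ∷ ○ ∷ ● ∷ ○ ∷ ● ∷ ○ ∷ []) ∷
               (● ∷ ○ ∷ ○ ∷ ● ∷ ● ∷ ○ ∷ []) ∷ (○ ∷ ● ∷ ● ∷ ○ ∷ ● ∷ ● ∷ []) ∷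
               (○ ∷ ● ∷ ○ ∷ ● ∷ ● ∷ ○ ∷ []) ∷ (○ ∷ ○ ∷ ● ∷ ● ∷ ○ ∷ ● ∷ []) ∷ []
bull∨K₁-mp = refl

bull∨K₁-gp : let open IsPattern bull∨K₁ in
             maximalFrees InducedP₃ InducedP₃? ≡
               (● ∷ ● ∷ ○ ∷ ● ∷ ○ ∷ ○ ∷ []) ∷ (● ∷ ● ∷ ○ ∷ ○ ∷ ○ ∷ ● ∷ []) ∷
               (● ∷ ○ ∷ ● ∷ ● ∷ ○ ∷ ○ ∷ []) ∷ (● ∷ ○ ∷ ● ∷ ○ ∷ ● ∷ ○ ∷ []) ∷
               (● ∷ ○ ∷ ○ ∷ ● ∷ ● ∷ ○ ∷ []) ∷ (○ ∷ ● ∷ ● ∷ ○ ∷ ● ∷ ● ∷ []) ∷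
               (○ ∷ ● ∷ ○ ∷ ● ∷ ● ∷ ○ ∷ []) ∷ (○ ∷ ○ ∷ ● ∷ ● ∷ ○ ∷ ● ∷ []) ∷ []
bull∨K₁-gp = refl

-- Realizing the admissible pairs

Realizable : ℕ → ℕ → Set
Realizable a b = ∃[ G ] (Connected G × MpMinus G a × GpMinus G b)

-- The blow-up of a point is complete, and its only maximal set of either kind is the full vertex
-- set.
realize-≡ : ∀ a → 1 ≤ a → Realizable a a
realize-≡ a 1≤a = G , connected
  , minMaximalSize OnInducedPath? mp-pullsBack (● ∷ []) tt (+-identityʳ a) (⟨ ≤-reflexive (sym (+-identityʳ a)) ⟩ ∷ [])
  , minMaximalSize InducedP₃? gp-pullsBack (● ∷ []) tt (+-identityʳ a) (⟨ ≤-reflexive (sym (+-identityʳ a)) ⟩ ∷ [])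
  where
  open IsPattern point
  open BlowUp point (a ∷ []) (1≤a ∷ [])

realize-< : ∀ i j → Realizable (2 + i) (3 + (i + j))
realize-< i j = G , connected
  , minMaximalSize OnInducedPath? mp-pullsBack (● ∷ ○ ∷ ○ ∷ ● ∷ ○ ∷ []) tt (cong (2 +_) (+-identityʳ i))
      (subst (All _) (sym gem-mp)
        ( byClass (# 4) a≤b
        ∷ byClass (# 2) a≤b
        ∷ ⟨ ≤-reflexive (cong (2 +_) (sym (+-identityʳ i))) ⟩
        ∷ byClass (# 2) a≤b
        ∷ ⟨ p₁p₃ ⟩
        ∷ byClass (# 2) a≤b
        ∷ []))
  , minMaximalSize InducedP₃? gp-pullsBack (● ∷ ● ∷ ○ ∷ ● ∷ ○ ∷ []) tt b≡
      (subst (All _) (sym gem-gp)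
        ( ⟨ ≤-reflexive (sym b≡) ⟩
        ∷ byClass (# 4) ≤-refl
        ∷ byClass (# 2) ≤-refl
        ∷ byClass (# 2) ≤-refl
        ∷ byClass (# 2) ≤-refl
        ∷ []))
  where
  b : ℕ
  b = 3 + (i + j)
  -- The set of p₀ and p₃ weighs `2 + i`, and adding p₁ gives `b`. With p₂ and the hub of weight
  -- `b`, the only other maximal set avoiding both is that of p₁ and p₃, of weight `2 + (i + j)`.
  w : Vec ℕ 5
  w = 1 ∷ 1 + j ∷ b ∷ 1 + i ∷ b ∷ []
  open IsPattern gem
  open BlowUp gem w (s≤s z≤n ∷ s≤s z≤n ∷ s≤s z≤n ∷ s≤s z≤n ∷ s≤s z≤n ∷ [])
  a≤b : 2 + i ≤ b
  a≤b = s≤s (s≤s (m≤n⇒m≤1+n (m≤m+n i j)))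
  j+1+i : j + (1 + i + 0) ≡ 1 + (i + j)
  j+1+i = trans (cong (λ k → j + suc k) (+-identityʳ i)) (trans (+-suc j i) (cong suc (+-comm j i)))
  b≡ : 2 + (j + (1 + i + 0)) ≡ b
  b≡ = cong (2 +_) j+1+i
  p₁p₃ : 2 + i ≤ 1 + (j + (1 + i + 0))
  p₁p₃ = s≤s (≤-trans (s≤s (m≤m+n i j)) (≤-reflexive (sym j+1+i)))

realize-> : ∀ i j → Realizable (4 + (i + j)) (3 + i)
realize-> i j = G , connected
  , minMaximalSize OnInducedPath? mp-pullsBack (● ∷ ● ∷ ○ ∷ ○ ∷ ○ ∷ ● ∷ []) tt a≡
      (subst (All _) (sym bull∨K₁-mp)
        ( ⟨ ≤-reflexive (sym a≡) ⟩
        ∷ byClass (# 2) ≤-refl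
        ∷ byClass (# 4) ≤-refl
        ∷ byClass (# 2) ≤-refl
        ∷ byClass (# 4) ≤-refl
        ∷ byClass (# 2) ≤-refl
        ∷ []))
  , minMaximalSize InducedP₃? gp-pullsBack (● ∷ ● ∷ ○ ∷ ● ∷ ○ ∷ ○ ∷ []) tt b≡
      (subst (All _) (sym bull∨K₁-gp)
        ( ⟨ ≤-reflexive (sym b≡) ⟩
        ∷ ⟨ ≤-trans b≤a (≤-reflexive (sym a≡)) ⟩
        ∷ byClass (# 2) b≤a
        ∷ byClass (# 2) b≤a
        ∷ byClass (# 4) b≤a
        ∷ byClass (# 2) b≤a
        ∷ byClass (# 4) b≤a
        ∷ byClass (# 2) b≤a
        ∷ []))
  where
  a : ℕ
  a = 4 + (i + j)
  -- The set of p₀, p₁ and p₃ weighs `3 + i`, that of p₀, p₁ and the hub weighs `a`. Every other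
  -- maximal set of either kind contains p₂ or c, both of weight `a`.
  w : Vec ℕ 6
  w = 1 ∷ 1 ∷ a ∷ 1 + i ∷ a ∷ 2 + (i + j) ∷ []
  open IsPattern bull∨K₁
  open BlowUp bull∨K₁ w (s≤s z≤n ∷ s≤s z≤n ∷ s≤s z≤n ∷ s≤s z≤n ∷ s≤s z≤n ∷ s≤s z≤n ∷ [])
  a≡ : 2 + (2 + (i + j) + 0) ≡ a
  a≡ = cong (4 +_) (+-identityʳ (i + j))
  b≡ : 2 + (1 + i + 0) ≡ 3 + i
  b≡ = cong (3 +_) (+-identityʳ i)
  b≤a : 3 + i ≤ a
  b≤a = +-mono-≤ (n≤1+n 3) (m≤m+n i j)

theorem6p1 : ∀ (a b : ℕ) → 1 ≤ a → 1 ≤ b →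
    (∃[ G ] (Connected G × MpMinus G a × GpMinus G b))
    ⇔ (a ≡ b ⊎ (2 ≤ a × a < b) ⊎ (3 ≤ b × b < a))
theorem6p1 a b 1≤a _ = mk⇔ necessary sufficient
  where
  necessary : Realizable a b → a ≡ b ⊎ (2 ≤ a × a < b) ⊎ (3 ≤ b × b < a)
  necessary (G , _ , mp⁻ , gp⁻) with <-cmp a b
  ... | tri≈ _ a≡b _ = inj₁ a≡b
  -- By contraposition: `a ≤ 1` would force `b ≤ a`. The next case likewise excludes `b ≤ 2`.
  ... | tri< a<b _ _ = inj₂ (inj₁ (≰⇒> (<⇒≱ a<b ∘ mp⁻≤1⇒gp⁻≤mp⁻ G mp⁻ gp⁻) , a<b))
  ... | tri> _ _ b<a = inj₂ (inj₂ (≰⇒> (<⇒≱ b<a ∘ gp⁻≤2⇒mp⁻≤gp⁻ G mp⁻ gp⁻) , b<a))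

  sufficient : a ≡ b ⊎ (2 ≤ a × a < b) ⊎ (3 ≤ b × b < a) → Realizable a b
  sufficient (inj₁ refl) = realize-≡ a 1≤a
  -- The strict inequality unfolds to `suc a ≤ b`, so `j` is `b` minus `a` minus 1, while `i` is `a`
  -- minus 2.
  sufficient (inj₂ (inj₁ (2≤a , a<b))) with m≤n⇒∃[o]m+o≡n 2≤a | m≤n⇒∃[o]m+o≡n a<b
  ... | i , refl | j , refl = realize-< i j
  sufficient (inj₂ (inj₂ (3≤b , b<a))) with m≤n⇒∃[o]m+o≡n 3≤b | m≤n⇒∃[o]m+o≡n b<a
  ... | i , refl | j , refl = realize-> i j
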